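{- Let $k$ be an odd integer that is not a prime power. Then there exist $m \ge 1$ and an induced subgraph $H$ of the torus $C_k^m$ such that $|V(H)|$ divides $k^m$, but there is no $n$ for which $C_k^n$ admits a perfect $H$-packing.
   Context: For integers $k \ge 3$ and $n \ge 1$, the torus $C_k^n$ (the $n$-th Cartesian power of the cycle $C_k$) is the graph with vertex set $\{0,\ldots,k-1\}^n$ in which two vertices $u$ and $v$ are adjacent if and only if they differ in exactly one coordinate $i$, and there $u_i - v_i \equiv \pm 1 \pmod k$. For graphs $G$ and $H$, an $H$-packing of $G$ is a collection of vertex-disjoint subgraphs of $G$ each isomorphic to $H$ (not necessarily induced); it is perfect if every vertex of $G$ lies in one of its members. -}

module Defs where

open import Data.Nat using (ℕ; zero; suc; _^_; _≤_)
open import Data.Nat.Divisibility using (_∣_)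
open import Data.Nat.Primality using (Prime)
open import Data.Fin using (Fin; toℕ)
open import Data.Vec using (Vec; lookup)
open import Data.List using (List; length)
import Data.List as L
open import Data.List.Relation.Unary.Unique.Propositional using (Unique)
open import Data.Product using (Σ; ∃; _×_; _,_)
open import Data.Sum using (_⊎_)
open import Relation.Binary.PropositionalEquality using (_≡_; _≢_)
open import Relation.Nullary using (¬_)

CycleAdj : (k : ℕ) → Fin k → Fin k → Set
CycleAdj k a b =
    (suc (toℕ a) ≡ toℕ b)
  ⊎ (suc (toℕ b) ≡ toℕ a)
  ⊎ (suc (toℕ a) ≡ k × toℕ b ≡ 0)
  ⊎ (suc (toℕ b) ≡ k × toℕ a ≡ 0)

Vertex : ℕ → ℕ → Set
Vertex k n = Vec (Fin k) n

TorusAdj : (k n : ℕ) → Vertex k n → Vertex k n → Set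
TorusAdj k n u v =
  Σ (Fin n) λ i →
    (∀ j → j ≢ i → lookup u j ≡ lookup v j) × CycleAdj k (lookup u i) (lookup v i)

-- An induced subgraph H of C_k^m, given by a duplicate-free list of its
-- vertices; its vertices are indexed by Fin (length vs) and its edges are
-- exactly the torus edges between them.
record InducedSubgraph (k m : ℕ) : Set where
  constructor induced
  field
    vs     : List (Vertex k m)
    unique : Unique vs

open InducedSubgraph public

order : ∀ {k m} → InducedSubgraph k m → ℕ
order H = length (vs H)

VH : ∀ {k m} → InducedSubgraph k m → Set
VH H = Fin (order H)

AdjH : ∀ {k m} → (H : InducedSubgraph k m) → VH H → VH H → Set
AdjH {k} {m} H x y = TorusAdj k m (L.lookup (vs H) x) (L.lookup (vs H) y)

-- A (not necessarily induced) subgraph of C_k^n isomorphic to H, given by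
-- an injective edge-preserving map φ : V(H) → V(C_k^n) (the copy is the
-- image of H under φ).
record Copy {k m : ℕ} (H : InducedSubgraph k m) (n : ℕ) : Set where
  field
    φ         : VH H → Vertex k n
    injective : ∀ x y → φ x ≡ φ y → x ≡ y
    edges     : ∀ x y → AdjH H x y → TorusAdj k n (φ x) (φ y)

open Copy public

record PerfectPacking {k m : ℕ} (H : InducedSubgraph k m) (n : ℕ) : Set where
  field
    size     : ℕ
    copies   : Fin size → Copy H n
    disjoint : ∀ c c' x x' → φ (copies c) x ≡ φ (copies c') x' → c ≡ c'
    covering : ∀ (v : Vertex k n) → Σ (Fin size) λ c → Σ (VH H) λ x → φ (copies c) x ≡ v

IsPrimePower : ℕ → Set
IsPrimePower k = Σ ℕ λ p → Σ ℕ λ e → Prime p × k ≡ p ^ e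

{-# OPTIONS --safe #-}
-- Write k = b a with a, b coprime and 1 < a < b, and colour a vertex of C_k^n by the residues mod a
-- of its coordinates.  The colour class 0 has b^n vertices, so no packing by copies of H can be
-- perfect if every copy of H meets this class in a multiple of a vertices.
--
-- Since k is odd, a closed walk of length k in C_k^n either lifts to a closed walk in ℤ^n, which
-- would have even length, or is a straight line.  So a copy of H maps every line contained in H to a
-- line, and two points of that line that are congruent mod a receive the same colour.  If the points
-- of H in one residue class mod a are linked by lines contained in H, then they all receive the same
-- colour; it remains to make the sizes of these classes multiples of a and their sum a power of k.
-- In C_k^3 take the points with x₁ < a² or x₂ < a², respectively x₁ < a² or x₂ < a² or x₃ < a².
-- With c = b - a each residue class contains a b (b + c), respectively a (b² + b c + c²), of them;
-- placing the first set over n₁ points of C_k^(n₁ + n₂) and the second over n₂ others, for suitable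
-- n₁ and n₂, gives k⁵ points in total.
module Submission where

open import Defs
open import Data.Nat
open import Data.Nat.Properties
open import Data.Nat.Divisibility
open import Data.Nat.DivMod
  using (_mod_; _%_; _/_; m%n<n; m<n⇒m%n≡m; [m+kn]%n≡m%n; n%n≡0; m*n%n≡0; m≡m%n+[m/n]*n)
open import Data.Nat.Coprimality as Coprimality using (Coprime; coprime-divisor)
open import Data.Nat.Induction using (<-rec)
open import Data.Nat.ListAction using (sum; product)
open import Data.Nat.ListAction.Properties using (sum-++; sum-↭)
open import Data.Nat.Primality using (Prime; prime⇒irreducible; prime⇒nonZero; prime⇒nonTrivial)
open import Data.Nat.Primality.Factorisation using (factorise)
open import Data.Nat.Tactic.RingSolver using (solve-∀)
open import Data.Fin
  using (Fin; zero; suc; toℕ; fromℕ<; combine; remainder; remQuot; _↑ˡ_; _↑ʳ_; splitAt)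
open import Data.Fin.Properties
  using ( toℕ<n; toℕ-fromℕ<; toℕ-injective; fromℕ<-injective; ¬∀⟶∃¬; all?
        ; toℕ-combine; combine-remQuot; remQuot-combine; combine-injective; combine-surjective
        ; splitAt-↑ˡ; splitAt-↑ʳ; splitAt⁻¹-↑ˡ; splitAt⁻¹-↑ʳ; ↑ˡ-injective; ↑ʳ-injective)
import Data.Fin.Properties as Fin
open import Data.List as List
  using (List; []; _∷_; _++_; length; allFin; cartesianProductWith; cartesianProduct)
open import Data.List.Properties
  using (map-++; map-∘; map-cong; map-tabulate; length-++; length-map; length-tabulate; tabulate-lookup)
open import Data.List.Membership.Propositional using (_∈_)
open import Data.List.Membership.Propositional.Properties
  using ( ∈-allFin; ∈-cartesianProductWith⁺; ∈-cartesianProduct⁺; ∈-cartesianProduct⁻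
        ; ∈-map⁺; ∈-map⁻; ∈-++⁺ˡ; ∈-++⁺ʳ; ∈-++⁻; ∈-lookup)
open import Data.List.Membership.Propositional.Properties.WithK
  using (unique∧set⇒bag; unique⇒irrelevant)
import Data.List.Membership.DecPropositional as DecMembership
open import Data.List.Relation.Binary.BagAndSetEquality using (∼bag⇒↭)
open import Data.List.Relation.Binary.Permutation.Propositional using (_↭_)
import Data.List.Relation.Binary.Permutation.Propositional.Properties as ↭
open import Data.List.Relation.Unary.All using ([]; _∷_)
open import Data.List.Relation.Unary.AllPairs using ([]; _∷_)
open import Data.List.Relation.Unary.Any using (here; there; index)
open import Data.List.Relation.Unary.Any.Properties using (lookup-index)
open import Data.List.Relation.Unary.Unique.Propositional using (Unique)
import Data.List.Relation.Unary.Unique.Propositional.Properties as Unique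
open import Data.Vec as Vec using ([]; _∷_; lookup; _[_]≔_; replicate)
open import Data.Vec.Properties
  using ( ∷-injective; ≡-dec; lookup-map; lookup-replicate; lookup∘updateAt; lookup∘updateAt′
        ; tabulate∘lookup; tabulate-cong)
open import Data.Product using (Σ; ∃; ∃₂; _×_; _,_; proj₁; proj₂; swap)
open import Data.Sum using (_⊎_; inj₁; inj₂)
open import Function using (_∘_; mk⇔)
open import Relation.Binary using (Tri; tri<; tri≈; tri>)
open import Relation.Binary.PropositionalEquality hiding ([_])
open import Relation.Nullary using (¬_; yes; no; contradiction)

private variable
  A B C : Set

-- Splitting off a full prime power

Coprime-* : ∀ {m n o} → Coprime m o → Coprime n o → Coprime (m * n) o
Coprime-* {m} {n} {o} m⊥o n⊥o {d} (d∣mn , d∣o) =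
  n⊥o (coprime-divisor {d} {m} (λ (e∣d , e∣m) → m⊥o (e∣m , ∣-trans e∣d d∣o)) d∣mn , d∣o)

Coprime-^ : ∀ {m o} e → Coprime m o → Coprime (m ^ e) o
Coprime-^ {o = o} zero    m⊥o = Coprimality.1-coprimeTo o
Coprime-^ {m}     (suc e) m⊥o = Coprime-* {m} m⊥o (Coprime-^ e m⊥o)

prime∤⇒Coprime : ∀ {p n} → Prime p → ¬ p ∣ n → Coprime p n
prime∤⇒Coprime p-prime p∤n (d∣p , d∣n) with prime⇒irreducible p-prime d∣p
... | inj₁ d≡1  = d≡1
... | inj₂ refl = contradiction d∣n p∤n

∃-prime-divisor : ∀ n → 2 ≤ n → ∃ λ p → Prime p × p ∣ n
∃-prime-divisor n@(suc _) 2≤n with factorise n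
... | record { factors = [] ; isFactorisation = n≡1 } = contradiction (sym n≡1) (<⇒≢ 2≤n)
... | record { factors = p ∷ ps ; isFactorisation = eq ; factorsPrime = p-prime ∷ _ } =
  p , p-prime , divides (product ps) (trans eq (*-comm p (product ps)))

strip-prime : ∀ {p} → Prime p → ∀ n → 1 ≤ n → ∃₂ λ e r → n ≡ p ^ e * r × ¬ p ∣ r
strip-prime {p} p-prime = <-rec _ strip
  where
  strip : ∀ n → (∀ {m} → m < n → 1 ≤ m → ∃₂ λ e r → m ≡ p ^ e * r × ¬ p ∣ r) →
          1 ≤ n → ∃₂ λ e r → n ≡ p ^ e * r × ¬ p ∣ r
  strip n rec 1≤n with p ∣? n
  ... | no p∤n = 0 , n , sym (+-identityʳ n) , p∤n
  ... | yes (divides zero eq) = contradiction 1≤n (subst (λ x → ¬ 1 ≤ x) (sym eq) λ ())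
  ... | yes (divides q@(suc _) refl)
    with e , r , q≡ , p∤r ← rec (m<m*n q p {{_}} (nonTrivial⇒n>1 p {{prime⇒nonTrivial p-prime}})) (s≤s z≤n)
    = suc e , r , trans (*-comm q p) (trans (cong (p *_) q≡) (sym (*-assoc p (p ^ e) r))) , p∤r

-- One factor is the full power of a prime `p` dividing `k`, the other is the cofactor `r`. A
-- cofactor 1 would make `k` a prime power, and coprime factors above 1 are distinct, so they can be
-- put in increasing order.
coprime-splitting : ∀ k → 2 ≤ k → ¬ IsPrimePower k →
                    ∃₂ λ a b → 1 < a × a < b × Coprime a b × k ≡ b * a
coprime-splitting k 2≤k not-pp
  with p , p-prime , p∣k ← ∃-prime-divisor k 2≤k
  with strip-prime p-prime k (≤-trans (s≤s z≤n) 2≤k)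
... | zero , r , k≡ , p∤r = contradiction (subst (p ∣_) (trans k≡ (+-identityʳ r)) p∣k) p∤r
... | suc e , zero , _ , p∤0 = contradiction (p ∣0) p∤0
... | suc e , 1 , k≡ , _ = contradiction (p , suc e , p-prime , trans k≡ (*-identityʳ _)) not-pp
... | suc e , r@(suc (suc _)) , k≡ , p∤r = order-factors (<-cmp q r)
  where
  q = p ^ suc e
  q⊥r : Coprime q r
  q⊥r = Coprime-^ (suc e) (prime∤⇒Coprime p-prime p∤r)
  1<p = nonTrivial⇒n>1 p {{prime⇒nonTrivial p-prime}}
  1<q : 1 < q
  1<q = ≤-trans 1<p (m≤m*n p (p ^ e) {{m^n≢0 p e {{prime⇒nonZero p-prime}}}})
  order-factors : Tri (q < r) (q ≡ r) (q > r) → ∃₂ λ a b → 1 < a × a < b × Coprime a b × k ≡ b * a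
  order-factors (tri< q<r _ _) = q , r , 1<q , q<r , q⊥r , trans k≡ (*-comm q r)
  order-factors (tri≈ _ q≡r _) = contradiction (q⊥r (∣-refl , ∣-reflexive q≡r)) (≢-sym (<⇒≢ 1<q))
  order-factors (tri> _ _ r<q) = r , q , s≤s (s≤s z≤n) , r<q , Coprimality.sym {q} {r} q⊥r , k≡

-- This is the vertex count of the final `H` divided by `a ^ 4 * b`: the first bracket is `n₁`, the
-- bracket `s * a + b` is `n₂` divided by `b`, and `1 + 2 * s` is `k`. Writing `s` as `suc s′`
-- expresses `s - 1` without subtraction.
multiplicity-identity : ∀ a c s′ → let b = a + c; s = suc s′ in
  (s * (a * a) + s′ * (b * c)) * (b + c) + (s * a + b) * (b * b + c * b + c * c) ≡ (1 + 2 * s) * (b * (b * b))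
multiplicity-identity = solve-∀

-- Congruences between natural numbers

infix 4 _≈_mod[_]
-- Multiples of the modulus are added on both sides, so that no subtraction and no integers are
-- needed.
_≈_mod[_] : ℕ → ℕ → ℕ → Set
x ≈ y mod[ m ] = ∃₂ λ p q → x + p * m ≡ y + q * m

module _ {m : ℕ} where

  ≈-reflexive : ∀ {x y} → x ≡ y → x ≈ y mod[ m ]
  ≈-reflexive x≡y = 0 , 0 , cong (_+ 0) x≡y

  ≈-sym : ∀ {x y} → x ≈ y mod[ m ] → y ≈ x mod[ m ]
  ≈-sym (p , q , eq) = q , p , sym eq

  ≈-trans : ∀ {x y z} → x ≈ y mod[ m ] → y ≈ z mod[ m ] → x ≈ z mod[ m ]
  ≈-trans {x} {y} {z} (p , q , eq) (p′ , q′ , eq′) = p + p′ , q + q′ , (begin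
    x + (p + p′) * m      ≡⟨ spread x p p′ m ⟩
    (x + p * m) + p′ * m  ≡⟨ cong (_+ p′ * m) eq ⟩
    (y + q * m) + p′ * m  ≡⟨ swap-last y (q * m) (p′ * m) ⟩
    (y + p′ * m) + q * m  ≡⟨ cong (_+ q * m) eq′ ⟩
    (z + q′ * m) + q * m  ≡⟨ swap-last z (q′ * m) (q * m) ⟩
    (z + q * m) + q′ * m  ≡⟨ spread z q q′ m ⟨
    z + (q + q′) * m      ∎)
    where
    open ≡-Reasoning
    spread : ∀ x p p′ m → x + (p + p′) * m ≡ (x + p * m) + p′ * m
    spread = solve-∀
    swap-last : ∀ x u v → (x + u) + v ≡ (x + v) + u
    swap-last = solve-∀

  ≈-+ : ∀ {x y u v} → x ≈ y mod[ m ] → u ≈ v mod[ m ] → x + u ≈ y + v mod[ m ]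
  ≈-+ {x} {y} {u} {v} (p , q , eq) (p′ , q′ , eq′) =
    p + p′ , q + q′ , trans (regroup x u p p′ m) (trans (cong₂ _+_ eq eq′) (sym (regroup y v q q′ m)))
    where
    regroup : ∀ x u p p′ m → x + u + (p + p′) * m ≡ (x + p * m) + (u + p′ * m)
    regroup = solve-∀

  ≈-cancelˡ : ∀ x {u v} → x + u ≈ x + v mod[ m ] → u ≈ v mod[ m ]
  ≈-cancelˡ x {u} {v} (p , q , eq) = p , q , +-cancelˡ-≡ x _ _
    (trans (sym (+-assoc x u (p * m))) (trans eq (+-assoc x v (q * m))))

  ≈-cancelʳ : ∀ z {u v} → u + z ≈ v + z mod[ m ] → u ≈ v mod[ m ]
  ≈-cancelʳ z {u} {v} = ≈-cancelˡ z ∘ subst₂ (_≈_mod[ m ]) (+-comm u z) (+-comm v z)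

  ≈-coarsen : ∀ {x y} b → x ≈ y mod[ b * m ] → x ≈ y mod[ m ]
  ≈-coarsen {x} {y} b (p , q , eq) = p * b , q * b ,
    trans (cong (x +_) (*-assoc p b m)) (trans eq (cong (y +_) (sym (*-assoc q b m))))

  ≈⇒≡ : ∀ {x y} → x ≈ y mod[ m ] → x < m → y < m → x ≡ y
  ≈⇒≡ {x} {y} (p , q , eq) x<m y<m = begin
    x                ≡⟨ m<n⇒m%n≡m x<m ⟨
    x % m            ≡⟨ [m+kn]%n≡m%n x p m ⟨
    (x + p * m) % m  ≡⟨ cong (_% m) eq ⟩
    (y + q * m) % m  ≡⟨ [m+kn]%n≡m%n y q m ⟩
    y % m            ≡⟨ m<n⇒m%n≡m y<m ⟩
    y                ∎
    where
    open ≡-Reasoning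
    instance m≢0 : NonZero m
             m≢0 = >-nonZero (≤-<-trans z≤n x<m)

  -- Two congruent numbers below `m` coincide. For a closed walk the ascents and descents in a
  -- coordinate are congruent mod `k`; if they differ, the larger count is therefore at least `k`.
  ≈⇒≤ : ∀ {x y} → x ≈ y mod[ m ] → x < y → m ≤ y
  ≈⇒≤ {x} {y} x≈y x<y with m ≤? y
  ... | yes m≤y = m≤y
  ... | no  m≰y = contradiction (≈⇒≡ x≈y (<-trans x<y (≰⇒> m≰y)) (≰⇒> m≰y)) (<⇒≢ x<y)

toℕ-≈-remainder : ∀ {b} a (x : Fin (b * a)) → toℕ x ≈ toℕ (remainder {b} a x) mod[ a ]
toℕ-≈-remainder {b} a x = 0 , toℕ q , (begin
  toℕ x + 0               ≡⟨ +-identityʳ (toℕ x) ⟩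
  toℕ x                   ≡⟨ cong toℕ (combine-remQuot {b} a x) ⟨
  toℕ (combine q r)       ≡⟨ toℕ-combine q r ⟩
  a * toℕ q + toℕ r       ≡⟨ +-comm (a * toℕ q) (toℕ r) ⟩
  toℕ r + a * toℕ q       ≡⟨ cong (toℕ r +_) (*-comm a (toℕ q)) ⟩
  toℕ r + toℕ q * a       ∎)
  where
  open ≡-Reasoning
  q = proj₁ (remQuot {b} a x)
  r = proj₂ (remQuot {b} a x)

≈⇒remainder≡ : ∀ {b} a {x y : Fin (b * a)} → toℕ x ≈ toℕ y mod[ a ] →
               remainder {b} a x ≡ remainder {b} a y
≈⇒remainder≡ {b} a {x} {y} x≈y = toℕ-injective (≈⇒≡
  (≈-trans (≈-sym (toℕ-≈-remainder {b} a x)) (≈-trans x≈y (toℕ-≈-remainder {b} a y)))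
  (toℕ<n _) (toℕ<n _))

remainder≡⇒≈ : ∀ {b} a {x y : Fin (b * a)} → remainder {b} a x ≡ remainder {b} a y →
               toℕ x ≈ toℕ y mod[ a ]
remainder≡⇒≈ {b} a {x} {y} eq =
  ≈-trans (toℕ-≈-remainder {b} a x)
    (≈-trans (≈-reflexive (cong toℕ eq)) (≈-sym (toℕ-≈-remainder {b} a y)))

-- Sums over the coordinates

∑ : ∀ {n} → (Fin n → ℕ) → ℕ
∑ {zero}  f = 0
∑ {suc n} f = f zero + ∑ (f ∘ suc)

∑-cong : ∀ {n} {f g : Fin n → ℕ} → (∀ i → f i ≡ g i) → ∑ f ≡ ∑ g
∑-cong {zero}  f≗g = refl
∑-cong {suc n} f≗g = cong₂ _+_ (f≗g zero) (∑-cong (f≗g ∘ suc))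

interchange : ∀ a b c d → (a + b) + (c + d) ≡ (a + c) + (b + d)
interchange = solve-∀

∑-+ : ∀ {n} (f g : Fin n → ℕ) → ∑ (λ i → f i + g i) ≡ ∑ f + ∑ g
∑-+ {zero}  f g = refl
∑-+ {suc n} f g = trans (cong (f zero + g zero +_) (∑-+ (f ∘ suc) (g ∘ suc)))
  (interchange (f zero) (g zero) (∑ (f ∘ suc)) (∑ (g ∘ suc)))

∑-0 : ∀ n → ∑ {n} (λ _ → 0) ≡ 0
∑-0 zero    = refl
∑-0 (suc n) = ∑-0 n

≤-∑ : ∀ {n} (f : Fin n → ℕ) i → f i ≤ ∑ f
≤-∑ f zero    = m≤m+n (f zero) _
≤-∑ f (suc i) = ≤-trans (≤-∑ (f ∘ suc) i) (m≤n+m _ (f zero))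

pair-≤-∑ : ∀ {n} (f : Fin n → ℕ) {i j} → i ≢ j → f i + f j ≤ ∑ f
pair-≤-∑ f {zero}  {zero}  i≢j = contradiction refl i≢j
pair-≤-∑ f {zero}  {suc j} i≢j = +-monoʳ-≤ (f zero) (≤-∑ (f ∘ suc) j)
pair-≤-∑ f {suc i} {zero}  i≢j =
  ≤-trans (≤-reflexive (+-comm (f (suc i)) (f zero))) (+-monoʳ-≤ (f zero) (≤-∑ (f ∘ suc) i))
pair-≤-∑ f {suc i} {suc j} i≢j =
  ≤-trans (pair-≤-∑ (f ∘ suc) (i≢j ∘ cong suc)) (m≤n+m _ (f zero))

at : ∀ {n} → Fin n → ℕ → Fin n → ℕ
at i x j with i Fin.≟ j
... | yes _ = x
... | no  _ = 0

at-≢ : ∀ {n} {i j : Fin n} x → i ≢ j → at i x j ≡ 0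
at-≢ {i = i} {j} x i≢j with i Fin.≟ j
... | yes i≡j = contradiction i≡j i≢j
... | no  _   = refl

at-≤ : ∀ {n} (i : Fin n) {x} j → x ≤ 1 → at i x j ≤ 1
at-≤ i j x≤1 with i Fin.≟ j
... | yes _ = x≤1
... | no  _ = z≤n

at-suc : ∀ {n} (i : Fin n) x j → at (suc i) x (suc j) ≡ at i x j
at-suc i x j with i Fin.≟ j
... | yes _ = refl
... | no  _ = refl

∑-at : ∀ {n} (i : Fin n) x → ∑ (at i x) ≡ x
∑-at {suc n} zero    x =
  trans (cong (x +_) (trans (∑-cong {n} (λ j → at-≢ {i = zero} {suc j} x (λ ()))) (∑-0 n))) (+-identityʳ x)
∑-at {suc n} (suc i) x = trans (∑-cong (at-suc i x)) (∑-at i x)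

-- Walks in the torus and their ascents and descents

module _ {k : ℕ} {a b : Fin k} where

  -- The last two alternatives of `CycleAdj` cross the seam between `k - 1` and 0. From `k - 1` to 0
  -- is an ascent, the reverse a descent, as in the lift of the cycle to the integers.
  ascent descent : CycleAdj k a b → ℕ
  ascent (inj₁ _)                = 1
  ascent (inj₂ (inj₁ _))         = 0
  ascent (inj₂ (inj₂ (inj₁ _)))  = 1
  ascent (inj₂ (inj₂ (inj₂ _)))  = 0
  descent (inj₁ _)               = 0
  descent (inj₂ (inj₁ _))        = 1
  descent (inj₂ (inj₂ (inj₁ _))) = 0
  descent (inj₂ (inj₂ (inj₂ _))) = 1

  ascent≤1 : (s : CycleAdj k a b) → ascent s ≤ 1
  ascent≤1 (inj₁ _)               = ≤-refl
  ascent≤1 (inj₂ (inj₁ _))        = z≤n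
  ascent≤1 (inj₂ (inj₂ (inj₁ _))) = ≤-refl
  ascent≤1 (inj₂ (inj₂ (inj₂ _))) = z≤n

  descent≤1 : (s : CycleAdj k a b) → descent s ≤ 1
  descent≤1 (inj₁ _)               = z≤n
  descent≤1 (inj₂ (inj₁ _))        = ≤-refl
  descent≤1 (inj₂ (inj₂ (inj₁ _))) = z≤n
  descent≤1 (inj₂ (inj₂ (inj₂ _))) = ≤-refl

  ascent+descent : (s : CycleAdj k a b) → ascent s + descent s ≡ 1
  ascent+descent (inj₁ _)               = refl
  ascent+descent (inj₂ (inj₁ _))        = refl
  ascent+descent (inj₂ (inj₂ (inj₁ _))) = refl
  ascent+descent (inj₂ (inj₂ (inj₂ _))) = refl

  step-balance : (s : CycleAdj k a b) → toℕ b + descent s ≈ toℕ a + ascent s mod[ k ]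
  step-balance (inj₁ a+1≡b) = ≈-reflexive
    (trans (+-identityʳ (toℕ b)) (trans (sym a+1≡b) (+-comm 1 (toℕ a))))
  step-balance (inj₂ (inj₁ b+1≡a)) = ≈-reflexive
    (trans (+-comm (toℕ b) 1) (trans b+1≡a (sym (+-identityʳ (toℕ a)))))
  step-balance (inj₂ (inj₂ (inj₁ (a+1≡k , b≡0)))) rewrite b≡0 =
    1 , 0 , trans (+-identityʳ k) (trans (sym a+1≡k) (sym (trans (+-identityʳ _) (+-comm (toℕ a) 1))))
  step-balance (inj₂ (inj₂ (inj₂ (b+1≡k , a≡0)))) rewrite a≡0 =
    0 , 1 , trans (+-identityʳ _) (trans (+-comm (toℕ b) 1) (trans b+1≡k (sym (+-identityʳ k))))

suc-% : ∀ k .{{_ : NonZero k}} t → suc t % k ≡ suc (t % k) % k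
suc-% k t = trans (cong (λ z → suc z % k) (m≡m%n+[m/n]*n t k)) ([m+kn]%n≡m%n (suc (t % k)) (t / k) k)

CycleAdj-mod : ∀ k .{{_ : NonZero k}} t → CycleAdj k (t mod k) (suc t mod k)
CycleAdj-mod k t
  rewrite toℕ-fromℕ< (m%n<n t k) | toℕ-fromℕ< (m%n<n (suc t) k)
  with m≤n⇒m<n∨m≡n (m%n<n t k)
... | inj₁ lt = inj₁ (sym (trans (suc-% k t) (m<n⇒m%n≡m lt)))
... | inj₂ eq = inj₂ (inj₂ (inj₁ (eq , trans (suc-% k t) (trans (cong (_% k) eq) (n%n≡0 k)))))

module _ {k n : ℕ} (w : ℕ → Vertex k n) (step : ∀ t → TorusAdj k n (w t) (w (suc t))) where

  count : (∀ {a b} → CycleAdj k a b → ℕ) → ℕ → Fin n → ℕ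
  count f zero    j = 0
  count f (suc t) j = let (i , _ , s) = step t in at i (f s) j + count f t j

  ascents descents : ℕ → Fin n → ℕ
  ascents  = count ascent
  descents = count descent

  count-growth : ∀ {f : ∀ {a b} → CycleAdj k a b → ℕ} → (∀ {a b} (s : CycleAdj k a b) → f s ≤ 1) →
                 ∀ d t j → count f (d + t) j ≤ d + count f t j
  count-growth f≤1 zero    t j = ≤-refl
  count-growth f≤1 (suc d) t j = let (i , _ , s) = step (d + t) in
    +-mono-≤ (at-≤ i j (f≤1 s)) (count-growth f≤1 d t j)

  ascents+descents : ∀ t → ∑ (λ j → ascents t j + descents t j) ≡ t
  ascents+descents zero    = ∑-0 n
  ascents+descents (suc t) = let (i , _ , s) = step t in begin
    ∑ (λ j → (at i (ascent s) j + ascents t j) + (at i (descent s) j + descents t j))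
      ≡⟨ ∑-cong (λ j → interchange (at i (ascent s) j) (ascents t j) (at i (descent s) j) (descents t j)) ⟩
    ∑ (λ j → (at i (ascent s) j + at i (descent s) j) + (ascents t j + descents t j))
      ≡⟨ ∑-+ (λ j → at i (ascent s) j + at i (descent s) j) (λ j → ascents t j + descents t j) ⟩
    ∑ (λ j → at i (ascent s) j + at i (descent s) j) + ∑ (λ j → ascents t j + descents t j)
      ≡⟨ cong₂ _+_ (∑-+ (at i (ascent s)) (at i (descent s))) (ascents+descents t) ⟩
    (∑ (at i (ascent s)) + ∑ (at i (descent s))) + t
      ≡⟨ cong (_+ t) (cong₂ _+_ (∑-at i (ascent s)) (∑-at i (descent s))) ⟩
    (ascent s + descent s) + t
      ≡⟨ cong (_+ t) (ascent+descent s) ⟩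
    suc t ∎
    where open ≡-Reasoning

  -- `step-balance` is summed along the walk. Descents stand on the left instead of being subtracted
  -- from the ascents on the right.
  walk-balance : ∀ t j →
    toℕ (lookup (w t) j) + descents t j ≈ toℕ (lookup (w 0) j) + ascents t j mod[ k ]
  walk-balance zero    j = ≈-reflexive refl
  walk-balance (suc t) j = let (i , same , s) = step t in
    advance (toℕ (lookup (w t) j)) (toℕ (lookup (w (suc t)) j)) (toℕ (lookup (w 0) j))
      (at i (descent s) j) (at i (ascent s) j) (descents t j) (ascents t j)
      (≈-step i same s) (walk-balance t j)
    where
    ≈-step : ∀ i → (∀ j → j ≢ i → lookup (w t) j ≡ lookup (w (suc t)) j) →
             (s : CycleAdj k (lookup (w t) i) (lookup (w (suc t)) i)) →
             toℕ (lookup (w (suc t)) j) + at i (descent s) j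
             ≈ toℕ (lookup (w t) j) + at i (ascent s) j mod[ k ]
    ≈-step i same s with i Fin.≟ j
    ... | yes refl = step-balance s
    ... | no  i≢j  = ≈-reflexive (cong (λ z → toℕ z + 0) (sym (same j (i≢j ∘ sym))))
    advance : ∀ x y z d u d′ u′ → y + d ≈ x + u mod[ k ] → x + d′ ≈ z + u′ mod[ k ] →
              y + (d + d′) ≈ z + (u + u′) mod[ k ]
    advance x y z d u d′ u′ y≈x x≈z =
      ≈-trans (≈-reflexive (sym (+-assoc y d d′)))
        (≈-trans (≈-+ y≈x (≈-reflexive {x = d′} refl))
          (≈-trans (≈-reflexive (move x u d′))
            (≈-trans (≈-+ x≈z (≈-reflexive {x = u} refl)) (≈-reflexive (finish z u′ u)))))
      where
      move : ∀ x u d′ → x + u + d′ ≡ x + d′ + u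
      move = solve-∀
      finish : ∀ z u′ u → z + u′ + u ≡ z + (u + u′)
      finish = solve-∀

  -- A closed walk with as many ascents as descents in every direction has even length.
  odd-closed-walk-winds : ¬ 2 ∣ k → w k ≡ w 0 → ∃ λ i → k ≤ ascents k i ⊎ k ≤ descents k i
  odd-closed-walk-winds 2∤k closed with all? (λ j → descents k j ≟ ascents k j)
  ... | yes balanced = contradiction (divides (∑ (ascents k)) (begin
      k                                          ≡⟨ ascents+descents k ⟨
      ∑ (λ j → ascents k j + descents k j)       ≡⟨ ∑-cong (λ j → cong (ascents k j +_) (balanced j)) ⟩
      ∑ (λ j → ascents k j + ascents k j)        ≡⟨ ∑-+ (ascents k) (ascents k) ⟩
      ∑ (ascents k) + ∑ (ascents k)              ≡⟨ double (∑ (ascents k)) ⟩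
      ∑ (ascents k) * 2                          ∎)) 2∤k
    where
    open ≡-Reasoning
    double : ∀ x → x + x ≡ x * 2
    double = solve-∀
  ... | no unbalanced
    with i , d≢u ← ¬∀⟶∃¬ n _ (λ j → descents k j ≟ ascents k j) unbalanced
    with d≈u ← ≈-cancelˡ (toℕ (lookup (w 0) i))
                 (subst (λ v → toℕ (lookup v i) + descents k i ≈ toℕ (lookup (w 0) i) + ascents k i mod[ k ])
                   closed (walk-balance k i))
    with <-cmp (descents k i) (ascents k i)
  ... | tri< d<u _ _ = i , inj₁ (≈⇒≤ d≈u d<u)
  ... | tri≈ _ d≡u _ = contradiction d≡u d≢u
  ... | tri> _ _ d>u = i , inj₂ (≈⇒≤ (≈-sym d≈u) d>u)

-- Winding walks are straight, and straight lines respect residues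

ZeroOrIdentity : ℕ → (ℕ → ℕ) → Set
ZeroOrIdentity k c = (∀ {t} → t ≤ k → c t ≡ t) ⊎ (∀ {t} → t ≤ k → c t ≡ 0)

-- There are only `k` steps, so a count that reaches `k` in coordinate `i` must grow at every step;
-- this leaves nothing for the other coordinates or for the opposite direction. `P` and `Q` are
-- abstract so that ascents and descents can exchange roles.
saturated : ∀ {k n} (P Q : ℕ → Fin n → ℕ) → (∀ t → ∑ (λ j → P t j + Q t j) ≡ t) →
            (∀ d t j → P (d + t) j ≤ d + P t j) → ∀ {i} → k ≤ P k i →
            ∀ j → ZeroOrIdentity k (λ t → P t j) × ZeroOrIdentity k (λ t → Q t j)
saturated {k} P Q total growth {i} k≤P = linear
  where
  -- The remaining `k ∸ t` steps add at most `k ∸ t`, so at least `t` is already there at time `t`.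
  t≤P : ∀ {t} → t ≤ k → t ≤ P t i
  t≤P {t} t≤k = +-cancelˡ-≤ (k ∸ t) t (P t i) (begin
    (k ∸ t) + t            ≡⟨ m∸n+n≡m t≤k ⟩
    k                      ≤⟨ k≤P ⟩
    P k i                  ≡⟨ cong (λ z → P z i) (m∸n+n≡m t≤k) ⟨
    P ((k ∸ t) + t) i      ≤⟨ growth (k ∸ t) t i ⟩
    (k ∸ t) + P t i        ∎)
    where open ≤-Reasoning
  P+Q≤t : ∀ t → P t i + Q t i ≤ t
  P+Q≤t t = ≤-trans (≤-∑ (λ j → P t j + Q t j) i) (≤-reflexive (total t))
  squeeze : ∀ {t x y} → t ≤ x → x + y ≤ t → y ≡ 0
  squeeze {t} {x} {y} t≤x x+y≤t =
    n≤0⇒n≡0 (+-cancelˡ-≤ x y 0 (≤-trans x+y≤t (≤-trans t≤x (≤-reflexive (sym (+-identityʳ x))))))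
  others : ∀ {t j} → i ≢ j → t ≤ k → P t j + Q t j ≡ 0
  others {t} i≢j t≤k = squeeze (≤-trans (t≤P t≤k) (m≤m+n _ (Q t i)))
    (≤-trans (pair-≤-∑ (λ j → P t j + Q t j) i≢j) (≤-reflexive (total t)))
  linear : ∀ j → ZeroOrIdentity k (λ t → P t j) × ZeroOrIdentity k (λ t → Q t j)
  linear j with i Fin.≟ j
  ... | yes refl = inj₁ (λ {t} t≤k → ≤-antisym (≤-trans (m≤m+n _ (Q t i)) (P+Q≤t t)) (t≤P t≤k))
                 , inj₂ (λ {t} t≤k → squeeze (t≤P t≤k) (P+Q≤t t))
  ... | no i≢j   = inj₂ (λ {t} t≤k → m+n≡0⇒m≡0 (P t j) (others i≢j t≤k))
                 , inj₂ (λ {t} t≤k → m+n≡0⇒n≡0 (P t j) (others i≢j t≤k))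

ZeroOrIdentity-≈ : ∀ {a k c t t′} → ZeroOrIdentity k c → t ≤ k → t′ ≤ k →
                   t ≈ t′ mod[ a ] → c t ≈ c t′ mod[ a ]
ZeroOrIdentity-≈ (inj₁ id) t≤k t′≤k t≈t′ =
  ≈-trans (≈-reflexive (id t≤k)) (≈-trans t≈t′ (≈-reflexive (sym (id t′≤k))))
ZeroOrIdentity-≈ (inj₂ null) t≤k t′≤k _ =
  ≈-reflexive (trans (null t≤k) (sym (null t′≤k)))

residue : ∀ {n} b a → Vertex (b * a) n → Vertex a n
residue b a = Vec.map (remainder {b} a)

-- Running once around the cycle gives a closed walk of odd length `k`, which winds and hence is
-- straight. Each coordinate of `g z` is then, mod `k`, constant or a constant plus or minus
-- `toℕ z`. Since `a` divides `k`, its residue mod `a` depends only on that of `z`.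
cycle-residue : ∀ {n} b a → ¬ 2 ∣ b * a → (g : Fin (b * a) → Vertex (b * a) n) →
  (∀ x y → CycleAdj (b * a) x y → TorusAdj (b * a) n (g x) (g y)) →
  ∀ {x y} → remainder {b} a x ≡ remainder {b} a y → residue b a (g x) ≡ residue b a (g y)
cycle-residue {n} b a 2∤k g hom {x} {y} x≡y = lookup-ext λ j →
  trans (lookup-map j (remainder {b} a) (g x))
    (trans (≈⇒remainder≡ {b} a (same-class j)) (sym (lookup-map j (remainder {b} a) (g y))))
  where
  k = b * a
  instance k≢0 : NonZero k
           k≢0 = >-nonZero (≤-<-trans z≤n (toℕ<n x))
  w : ℕ → Vertex k n
  w t = g (t mod k)
  step : ∀ t → TorusAdj k n (w t) (w (suc t))
  step t = hom _ _ (CycleAdj-mod k t)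
  mod-cong : ∀ {s t} → s % k ≡ t % k → w s ≡ w t
  mod-cong {s} {t} eq = cong g (toℕ-injective
    (trans (toℕ-fromℕ< (m%n<n s k)) (trans eq (sym (toℕ-fromℕ< (m%n<n t k))))))
  w-toℕ : ∀ z → w (toℕ z) ≡ g z
  w-toℕ z = cong g (toℕ-injective (trans (toℕ-fromℕ< (m%n<n (toℕ z) k)) (m<n⇒m%n≡m (toℕ<n z))))
  linear : ∀ j → ZeroOrIdentity k (λ t → ascents w step t j) × ZeroOrIdentity k (λ t → descents w step t j)
  linear j with odd-closed-walk-winds w step 2∤k (mod-cong (trans (n%n≡0 k) (sym (m*n%n≡0 0 k))))
  ... | i , inj₁ k≤u = saturated (ascents w step) (descents w step)
          (ascents+descents w step) (count-growth w step ascent≤1) k≤u j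
  ... | i , inj₂ k≤d = swap (saturated (descents w step) (ascents w step)
          (λ t → trans (∑-cong (λ j → +-comm (descents w step t j) _)) (ascents+descents w step t))
          (count-growth w step descent≤1) k≤d j)
  balance : ∀ z j → toℕ (lookup (g z) j) + descents w step (toℕ z) j
                    ≈ toℕ (lookup (w 0) j) + ascents w step (toℕ z) j mod[ a ]
  balance z j = ≈-coarsen b (subst
    (λ v → toℕ (lookup v j) + descents w step (toℕ z) j
           ≈ toℕ (lookup (w 0) j) + ascents w step (toℕ z) j mod[ k ])
    (w-toℕ z) (walk-balance w step (toℕ z) j))
  same-count : ∀ {c} → ZeroOrIdentity k c → c (toℕ x) ≈ c (toℕ y) mod[ a ]
  same-count lin = ZeroOrIdentity-≈ lin (<⇒≤ (toℕ<n x)) (<⇒≤ (toℕ<n y)) (remainder≡⇒≈ {b} a x≡y)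
  same-class : ∀ j → toℕ (lookup (g x) j) ≈ toℕ (lookup (g y) j) mod[ a ]
  -- Both balances are compared through the common start `w 0`; the descents at `y` are exchanged
  -- for the congruent descents at `x`, which then cancel.
  same-class j = ≈-cancelʳ (descents w step (toℕ x) j)
    (≈-trans (balance x j)
    (≈-trans (≈-+ (≈-reflexive refl) (same-count (proj₁ (linear j))))
    (≈-trans (≈-sym (balance y j))
             (≈-+ (≈-reflexive refl) (≈-sym (same-count (proj₂ (linear j))))))))
  lookup-ext : ∀ {u v : Vertex a n} → (∀ j → lookup u j ≡ lookup v j) → u ≡ v
  lookup-ext {u} {v} eq = trans (sym (tabulate∘lookup u)) (trans (tabulate-cong eq) (tabulate∘lookup v))

-- Sums over lists and products of lists

sumOf : (A → ℕ) → List A → ℕ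
sumOf f xs = sum (List.map f xs)

sumOf-++ : ∀ (f : A → ℕ) xs ys → sumOf f (xs ++ ys) ≡ sumOf f xs + sumOf f ys
sumOf-++ f xs ys = trans (cong sum (map-++ f xs ys)) (sum-++ (List.map f xs) (List.map f ys))

sumOf-map : ∀ (f : B → ℕ) (g : A → B) xs → sumOf f (List.map g xs) ≡ sumOf (f ∘ g) xs
sumOf-map f g xs = cong sum (sym (map-∘ xs))

sumOf-cong : ∀ {f g : A → ℕ} → (∀ x → f x ≡ g x) → ∀ xs → sumOf f xs ≡ sumOf g xs
sumOf-cong f≗g xs = cong sum (map-cong f≗g xs)

sumOf-* : ∀ m (f : A → ℕ) xs → sumOf (λ x → m * f x) xs ≡ m * sumOf f xs
sumOf-* m f []       = sym (*-zeroʳ m)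
sumOf-* m f (x ∷ xs) = trans (cong (m * f x +_) (sumOf-* m f xs)) (sym (*-distribˡ-+ m (f x) (sumOf f xs)))

sumOf-const : ∀ {f : A → ℕ} {c} xs → (∀ {x} → x ∈ xs → f x ≡ c) → sumOf f xs ≡ length xs * c
sumOf-const []       f≡c = refl
sumOf-const (x ∷ xs) f≡c = cong₂ _+_ (f≡c (here refl)) (sumOf-const xs (f≡c ∘ there))

sumOf-product : ∀ (h : C → ℕ) (g : A → B → C) {p : A → ℕ} {q : B → ℕ} →
                (∀ x y → h (g x y) ≡ p x * q y) →
                ∀ xs ys → sumOf h (cartesianProductWith g xs ys) ≡ sumOf p xs * sumOf q ys
sumOf-product h g         h≡ []       ys = refl
sumOf-product h g {p} {q} h≡ (x ∷ xs) ys = begin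
  sumOf h (List.map (g x) ys ++ cartesianProductWith g xs ys)
    ≡⟨ sumOf-++ h (List.map (g x) ys) _ ⟩
  sumOf h (List.map (g x) ys) + sumOf h (cartesianProductWith g xs ys)
    ≡⟨ cong₂ _+_ (trans (sumOf-map h (g x) ys) (trans (sumOf-cong (h≡ x) ys) (sumOf-* (p x) q ys)))
                 (sumOf-product h g h≡ xs ys) ⟩
  p x * sumOf q ys + sumOf p xs * sumOf q ys
    ≡⟨ *-distribʳ-+ (sumOf q ys) (p x) (sumOf p xs) ⟨
  (p x + sumOf p xs) * sumOf q ys ∎
  where open ≡-Reasoning

∣-sumOf-product : ∀ {d} (h : C → ℕ) (g : A → B → C) xs ys →
                  (∀ {x} → x ∈ xs → d ∣ sumOf (h ∘ g x) ys) →
                  d ∣ sumOf h (cartesianProductWith g xs ys)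
∣-sumOf-product {d = d} h g []       ys d∣ = d ∣0
∣-sumOf-product {d = d} h g (x ∷ xs) ys d∣ =
  subst (d ∣_) (sym (sumOf-++ h (List.map (g x) ys) _))
    (∣m∣n⇒∣m+n (subst (d ∣_) (sym (sumOf-map h (g x) ys)) (d∣ (here refl)))
               (∣-sumOf-product h g xs ys (d∣ ∘ there)))

sumOf-↭ : ∀ (f : A → ℕ) {xs ys} → xs ↭ ys → sumOf f xs ≡ sumOf f ys
sumOf-↭ f xs↭ys = sum-↭ (↭.map⁺ f xs↭ys)

unique∧complete⇒↭ : ∀ {xs ys : List A} → Unique xs → Unique ys →
                    (∀ x → x ∈ xs) → (∀ x → x ∈ ys) → xs ↭ ys
unique∧complete⇒↭ ux uy all∈xs all∈ys =
  ∼bag⇒↭ (unique∧set⇒bag ux uy (mk⇔ (λ _ → all∈ys _) (λ _ → all∈xs _)))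

-- The colour class 0 and the obstruction to packings

δ₀ : ∀ {a} → Fin a → ℕ
δ₀ zero    = 1
δ₀ (suc _) = 0

δ₀ⁿ : ∀ {a n} → Vertex a n → ℕ
δ₀ⁿ []      = 1
δ₀ⁿ (x ∷ v) = δ₀ x * δ₀ⁿ v

-- The indicator function of colour class 0, so that its sum over distinct vertices counts the
-- members of that class.
weight : ∀ {n} b a → Vertex (b * a) n → ℕ
weight b a v = δ₀ⁿ (residue b a v)

-- Listing `Fin (b * a)` by quotient and remainder makes the sum of `δ₀` of the remainder factor
-- into `b` times 1.
coordinates : ∀ b a → List (Fin (b * a))
coordinates b a = cartesianProductWith combine (allFin b) (allFin a)

vertices : ∀ b a n → List (Vertex (b * a) n)
vertices b a zero    = [] ∷ []
vertices b a (suc n) = cartesianProductWith _∷_ (coordinates b a) (vertices b a n)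

∈-coordinates : ∀ b a x → x ∈ coordinates b a
∈-coordinates b a x with q , r , refl ← combine-surjective {b} {a} x =
  ∈-cartesianProductWith⁺ combine (∈-allFin q) (∈-allFin r)

∈-vertices : ∀ b a {n} (v : Vertex (b * a) n) → v ∈ vertices b a n
∈-vertices b a []      = here refl
∈-vertices b a (x ∷ v) = ∈-cartesianProductWith⁺ _∷_ (∈-coordinates b a x) (∈-vertices b a v)

vertices-unique : ∀ b a n → Unique (vertices b a n)
vertices-unique b a zero    = [] ∷ []
vertices-unique b a (suc n) = Unique.cartesianProductWith⁺ _∷_ ∷-injective
  (Unique.cartesianProductWith⁺ combine (combine-injective _ _ _ _) (Unique.allFin⁺ b) (Unique.allFin⁺ a))
  (vertices-unique b a n)

sumOf-δ₀ : ∀ a .{{_ : NonZero a}} → sumOf δ₀ (allFin a) ≡ 1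
sumOf-δ₀ (suc a) = cong suc (trans (cong sum (map-tabulate {n = a} suc δ₀)) (zeros a))
  where
  zeros : ∀ n → sum (List.tabulate {n = n} (λ _ → 0)) ≡ 0
  zeros zero    = refl
  zeros (suc n) = zeros n

sumOf-weight-vertices : ∀ b a .{{_ : NonZero a}} n → sumOf (weight b a) (vertices b a n) ≡ b ^ n
sumOf-weight-vertices b a zero    = refl
sumOf-weight-vertices b a (suc n) =
  trans (sumOf-product (weight b a) _∷_ (λ _ _ → refl) (coordinates b a) (vertices b a n))
        (cong₂ _*_ coordinate-weight (sumOf-weight-vertices b a n))
  where
  coordinate-weight : sumOf (δ₀ ∘ remainder {b} a) (coordinates b a) ≡ b
  coordinate-weight = begin
    sumOf (δ₀ ∘ remainder {b} a) (coordinates b a)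
      ≡⟨ sumOf-product _ combine {p = λ _ → 1}
           (λ q r → trans (cong (δ₀ ∘ proj₂) (remQuot-combine q r)) (sym (+-identityʳ (δ₀ r))))
           (allFin b) (allFin a) ⟩
    sumOf (λ _ → 1) (allFin b) * sumOf δ₀ (allFin a)
      ≡⟨ cong₂ _*_ (sumOf-const (allFin b) (λ _ → refl)) (sumOf-δ₀ a) ⟩
    (length (allFin b) * 1) * 1
      ≡⟨ trans (*-identityʳ _) (trans (*-identityʳ _) (length-tabulate {n = b} _)) ⟩
    b ∎
    where open ≡-Reasoning

-- A perfect packing partitions the vertices, so the `b ^ n` vertices of colour 0 would be counted
-- in multiples of `a`. But `a` exceeds 1 and is coprime to `b ^ n`.
divisible-weight⇒no-packing : ∀ {m} b a → 1 < a → Coprime a b → (H : InducedSubgraph (b * a) m) →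
  (∀ {n} (K : Copy H n) → a ∣ sumOf (weight b a ∘ φ K) (allFin (order H))) →
  ∀ n → ¬ PerfectPacking H n
divisible-weight⇒no-packing b a 1<a a⊥b H a∣copy n packing =
  contradiction (a⊥bⁿ (∣-refl , a∣bⁿ)) (>⇒≢ 1<a)
  where
  open PerfectPacking packing
  instance a≢0 : NonZero a
           a≢0 = >-nonZero (<-trans z<s 1<a)
  a⊥bⁿ : Coprime a (b ^ n)
  a⊥bⁿ = Coprimality.sym {b ^ n} {a} (Coprime-^ n (Coprimality.sym {a} {b} a⊥b))
  place : Fin size → VH H → Vertex (b * a) n
  place c x = φ (copies c) x
  covered = cartesianProductWith place (allFin size) (allFin (order H))
  place-injective : ∀ {c c′ x x′} → place c x ≡ place c′ x′ → c ≡ c′ × x ≡ x′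
  place-injective {c} {c′} eq with refl ← disjoint c c′ _ _ eq = refl , injective (copies c) _ _ eq
  ∈-covered : ∀ v → v ∈ covered
  ∈-covered v with c , x , refl ← covering v = ∈-cartesianProductWith⁺ place (∈-allFin c) (∈-allFin x)
  -- Disjointness and injectivity rule out repetitions in `covered`, and `covering` makes it
  -- complete.
  covered↭vertices : covered ↭ vertices b a n
  covered↭vertices = unique∧complete⇒↭
    (Unique.cartesianProductWith⁺ place place-injective (Unique.allFin⁺ _) (Unique.allFin⁺ _))
    (vertices-unique b a n) ∈-covered (∈-vertices b a)
  a∣bⁿ : a ∣ b ^ n
  a∣bⁿ = subst (a ∣_) (trans (sumOf-↭ (weight b a) covered↭vertices) (sumOf-weight-vertices b a n))
    (∣-sumOf-product (weight b a) place (allFin size) (allFin (order H)) (λ {c} _ → a∣copy (copies c)))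

-- Lists split by a low or high first entry

length-cartesianProduct : ∀ (xs : List A) (ys : List B) →
                          length (cartesianProduct xs ys) ≡ length xs * length ys
length-cartesianProduct []       ys = refl
length-cartesianProduct (x ∷ xs) ys = trans (length-++ (List.map (x ,_) ys))
  (cong₂ _+_ (length-map (x ,_) ys) (length-cartesianProduct xs ys))

lows : ∀ m n → List (Fin (m + n))
lows m n = List.map (_↑ˡ n) (allFin m)

highs : ∀ m n → List (Fin (m + n))
highs m n = List.map (m ↑ʳ_) (allFin n)

length-allFin : ∀ n → length (allFin n) ≡ n
length-allFin n = length-tabulate {n = n} _

length-lows : ∀ m n → length (lows m n) ≡ m
length-lows m n = trans (length-map _ (allFin m)) (length-allFin m)

length-highs : ∀ m n → length (highs m n) ≡ n
length-highs m n = trans (length-map _ (allFin n)) (length-allFin n)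

low⊎high : ∀ m n x → x ∈ lows m n ⊎ x ∈ highs m n
low⊎high m n x with splitAt m x in eq
... | inj₁ i = inj₁ (subst (_∈ lows m n) (splitAt⁻¹-↑ˡ eq) (∈-map⁺ (_↑ˡ n) (∈-allFin i)))
... | inj₂ j = inj₂ (subst (_∈ highs m n) (splitAt⁻¹-↑ʳ eq) (∈-map⁺ (m ↑ʳ_) (∈-allFin j)))

low∧high⇒⊥ : ∀ m n {x} → x ∈ lows m n → ¬ x ∈ highs m n
low∧high⇒⊥ m n x∈lows x∈highs
  with i , _ , x≡l ← ∈-map⁻ (_↑ˡ n) x∈lows
  with j , _ , x≡h ← ∈-map⁻ (m ↑ʳ_) x∈highs
  with () ← trans (sym (splitAt-↑ˡ m i n)) (trans (cong (splitAt m) (trans (sym x≡l) x≡h)) (splitAt-↑ʳ m n j))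

lows-unique : ∀ m n → Unique (lows m n)
lows-unique m n = Unique.map⁺ (↑ˡ-injective n _ _) (Unique.allFin⁺ m)

-- Used at two levels: inside a slab to avoid counting a triple twice, and in `H` to put one kind of
-- slab over `n₁` tags and another over `n₂` tags.
split : ∀ m n → List A → List A → List (Fin (m + n) × A)
split m n ys zs = cartesianProduct (lows m n) ys ++ cartesianProduct (highs m n) zs

module _ (m n : ℕ) {ys zs : List A} where

  length-split : length (split m n ys zs) ≡ m * length ys + n * length zs
  length-split = trans (length-++ (cartesianProduct (lows m n) ys)) (cong₂ _+_
    (trans (length-cartesianProduct (lows m n) ys) (cong (_* length ys) (length-lows m n)))
    (trans (length-cartesianProduct (highs m n) zs) (cong (_* length zs) (length-highs m n))))

  split-unique : Unique ys → Unique zs → Unique (split m n ys zs)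
  split-unique ys! zs! = Unique.++⁺
    (Unique.cartesianProduct⁺ (lows-unique m n) ys!)
    (Unique.cartesianProduct⁺ (Unique.map⁺ (↑ʳ-injective m _ _) (Unique.allFin⁺ n)) zs!)
    (λ (p , q) → low∧high⇒⊥ m n (proj₁ (∈-cartesianProduct⁻ (lows m n) ys p))
                                (proj₁ (∈-cartesianProduct⁻ (highs m n) zs q)))

  ∈-split-low : ∀ {x y} → x ∈ lows m n → y ∈ ys → (x , y) ∈ split m n ys zs
  ∈-split-low x∈ y∈ = ∈-++⁺ˡ (∈-cartesianProduct⁺ x∈ y∈)

  ∈-split-high : ∀ {x y} → x ∈ highs m n → y ∈ zs → (x , y) ∈ split m n ys zs
  ∈-split-high x∈ y∈ = ∈-++⁺ʳ (cartesianProduct (lows m n) ys) (∈-cartesianProduct⁺ x∈ y∈)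

  ∈-split⁻ : ∀ {x y} → (x , y) ∈ split m n ys zs →
             (x ∈ lows m n × y ∈ ys) ⊎ (x ∈ highs m n × y ∈ zs)
  ∈-split⁻ p with ∈-++⁻ (cartesianProduct (lows m n) ys) p
  ... | inj₁ q = inj₁ (∈-cartesianProduct⁻ (lows m n) ys q)
  ... | inj₂ q = inj₂ (∈-cartesianProduct⁻ (highs m n) zs q)

-- Slabs and their connection by full lines

Triple : ℕ → Set
Triple n = Fin n × Fin n × Fin n

allTriples : ∀ n → List (Triple n)
allTriples n = cartesianProduct (allFin n) (cartesianProduct (allFin n) (allFin n))

∈-allTriples : ∀ {n} (t : Triple n) → t ∈ allTriples n
∈-allTriples (x , y , z) = ∈-cartesianProduct⁺ (∈-allFin x) (∈-cartesianProduct⁺ (∈-allFin y) (∈-allFin z))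

length-allTriples : ∀ n → length (allTriples n) ≡ n * (n * n)
length-allTriples n = trans (length-cartesianProduct (allFin n) _) (cong₂ _*_ (length-allFin n)
  (trans (length-cartesianProduct (allFin n) (allFin n)) (cong₂ _*_ (length-allFin n) (length-allFin n))))

allTriples-unique : ∀ n → Unique (allTriples n)
allTriples-unique n = Unique.cartesianProduct⁺ (Unique.allFin⁺ n)
  (Unique.cartesianProduct⁺ (Unique.allFin⁺ n) (Unique.allFin⁺ n))

-- Enumerates without repetition the triples having a low entry in one of the first two places or an
-- entry from zs in the third.
slab : ∀ a c → List (Fin (a + c)) → List (Triple (a + c))
slab a c zs = split a c (cartesianProduct (allFin (a + c)) (allFin (a + c)))
                        (split a c (allFin (a + c)) zs)

-- Each field asks for the whole line to lie in `T`, because only a full line supplies a cycle of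
-- length `k` on which the walk argument works.
record LineConstant {n} (T : List (Triple n)) (f : Triple n → A) : Set where
  field
    line₁ : ∀ {y z} → (∀ x → (x , y , z) ∈ T) → ∀ x x′ → f (x , y , z) ≡ f (x′ , y , z)
    line₂ : ∀ {x z} → (∀ y → (x , y , z) ∈ T) → ∀ y y′ → f (x , y , z) ≡ f (x , y′ , z)
    line₃ : ∀ {x y} → (∀ z → (x , y , z) ∈ T) → ∀ z z′ → f (x , y , z) ≡ f (x , y , z′)

module _ (a c : ℕ) {zs : List (Fin (a + c))} where

  private
    b = a + c
    T = slab a c zs

  length-slab : length T ≡ a * (b * b) + c * (a * b + c * length zs)
  length-slab = trans (length-split a c) (cong₂ (λ l m → a * l + c * m)
    (trans (length-cartesianProduct (allFin b) (allFin b)) (cong₂ _*_ (length-allFin b) (length-allFin b)))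
    (trans (length-split a c) (cong (λ l → a * l + c * length zs) (length-allFin b))))

  slab-unique : Unique zs → Unique T
  slab-unique zs! = split-unique a c (Unique.cartesianProduct⁺ (Unique.allFin⁺ b) (Unique.allFin⁺ b))
    (split-unique a c (Unique.allFin⁺ b) zs!)

  ∈-slab₁ : ∀ {x y z} → x ∈ lows a c → (x , y , z) ∈ T
  ∈-slab₁ x∈ = ∈-split-low a c x∈ (∈-cartesianProduct⁺ (∈-allFin _) (∈-allFin _))

  ∈-slab₂ : ∀ {x y z} → y ∈ lows a c → (x , y , z) ∈ T
  ∈-slab₂ {x} y∈ with low⊎high a c x
  ... | inj₁ x∈ = ∈-slab₁ x∈
  ... | inj₂ x∈ = ∈-split-high a c x∈ (∈-split-low a c y∈ (∈-allFin _))

  ∈-slab₃ : ∀ {x y z} → z ∈ zs → (x , y , z) ∈ T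
  ∈-slab₃ {x} {y} z∈ with low⊎high a c x | low⊎high a c y
  ... | inj₁ x∈ | _       = ∈-slab₁ x∈
  ... | inj₂ x∈ | inj₁ y∈ = ∈-slab₂ y∈
  ... | inj₂ x∈ | inj₂ y∈ = ∈-split-high a c x∈ (∈-split-high a c y∈ z∈)

  ∈-slab⁻ : ∀ {x y z} → (x , y , z) ∈ T → x ∈ lows a c ⊎ y ∈ lows a c ⊎ z ∈ zs
  ∈-slab⁻ t∈ with ∈-split⁻ a c t∈
  ... | inj₁ (x∈ , _) = inj₁ x∈
  ... | inj₂ (_ , yz∈) with ∈-split⁻ a c yz∈
  ... | inj₁ (y∈ , _) = inj₂ (inj₁ y∈)
  ... | inj₂ (_ , z∈) = inj₂ (inj₂ z∈)

  -- A low or `zs` entry keeps the point in the slab while the other entries move freely. They move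
  -- to `o` first; the low `o` in place 1 or 2 then keeps the point in the slab while the original
  -- entry moves. `o` need not lie in `zs`, so the empty `zs` is covered too.
  slab-connected : ∀ {f : Triple b → A} → LineConstant T f →
                   ∀ {o} → o ∈ lows a c → ∀ {t} → t ∈ T → f t ≡ f (o , o , o)
  slab-connected const {o} o∈ {x , y , z} t∈ = go (∈-slab⁻ t∈)
    where
    open LineConstant const
    go : x ∈ lows a c ⊎ y ∈ lows a c ⊎ z ∈ zs → _
    go (inj₁ x∈) =
      trans (line₂ (λ _ → ∈-slab₁ x∈) y o)
      (trans (line₃ (λ _ → ∈-slab₁ x∈) z o)
             (line₁ (λ _ → ∈-slab₂ o∈) x o))
    go (inj₂ (inj₁ y∈)) =
      trans (line₁ (λ _ → ∈-slab₂ y∈) x o)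
      (trans (line₂ (λ _ → ∈-slab₁ o∈) y o)
             (line₃ (λ _ → ∈-slab₁ o∈) z o))
    go (inj₂ (inj₂ z∈)) =
      trans (line₁ (λ _ → ∈-slab₃ z∈) x o)
      (trans (line₂ (λ _ → ∈-slab₁ o∈) y o)
             (line₃ (λ _ → ∈-slab₁ o∈) z o))

-- Copies of H as maps on torus vertices

module _ {k m : ℕ} (H : InducedSubgraph k m) {n : ℕ} (K : Copy H n) (default : Vertex k n) where

  open DecMembership (≡-dec {n = m} (Fin._≟_ {k})) using (_∈?_)

  -- A copy is indexed by list positions, while lines are described by coordinates. The total map
  -- bridges the two; `default` is an arbitrary value off `H`.
  extension : Vertex k m → Vertex k n
  extension v with v ∈? vs H
  ... | yes v∈ = φ K (index v∈)
  ... | no  _  = default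

  -- The list `vs H` has no repetitions, so the membership proof found by the decision procedure
  -- agrees with the given one.
  extension-∈ : ∀ {v} (v∈ : v ∈ vs H) → extension v ≡ φ K (index v∈)
  extension-∈ {v} v∈ with v ∈? vs H
  ... | yes v∈′ = cong (φ K ∘ index) (unique⇒irrelevant (unique H) v∈′ v∈)
  ... | no  v∉  = contradiction v∈ v∉

  extension-adj : ∀ {u v} → u ∈ vs H → v ∈ vs H → TorusAdj k m u v →
                  TorusAdj k n (extension u) (extension v)
  extension-adj u∈ v∈ adj = subst₂ (TorusAdj k n) (sym (extension-∈ u∈)) (sym (extension-∈ v∈))
    (edges K _ _ (subst₂ (TorusAdj k m) (lookup-index u∈) (lookup-index v∈) adj))

  sumOf-extension : ∀ (h : Vertex k n → ℕ) → sumOf (h ∘ φ K) (allFin (order H)) ≡ sumOf (h ∘ extension) (vs H)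
  sumOf-extension h = begin
    sumOf (h ∘ φ K) (allFin (order H))
      ≡⟨ sumOf-cong (λ i → cong h (trans (cong (φ K) (index-∈-lookup (vs H) i))
                                         (sym (extension-∈ (∈-lookup i))))) (allFin (order H)) ⟩
    sumOf (h ∘ extension ∘ List.lookup (vs H)) (allFin (order H))
      ≡⟨ sumOf-map (h ∘ extension) (List.lookup (vs H)) (allFin (order H)) ⟨
    sumOf (h ∘ extension) (List.map (List.lookup (vs H)) (allFin (order H)))
      ≡⟨ cong (sumOf (h ∘ extension))
           (trans (map-tabulate (λ i → i) (List.lookup (vs H))) (tabulate-lookup (vs H))) ⟩
    sumOf (h ∘ extension) (vs H) ∎
    where
    open ≡-Reasoning
    index-∈-lookup : ∀ {A : Set} (xs : List A) i → i ≡ index (∈-lookup {xs = xs} i)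
    index-∈-lookup (x ∷ xs) zero    = refl
    index-∈-lookup (x ∷ xs) (suc i) = cong suc (index-∈-lookup xs i)

TorusAdj-update : ∀ {k m} (v : Vertex k m) i {x y} → CycleAdj k x y →
                  TorusAdj k m (v [ i ]≔ x) (v [ i ]≔ y)
TorusAdj-update {k} v i {x} {y} adj = i
  , (λ j j≢i → trans (lookup∘updateAt′ j i j≢i v) (sym (lookup∘updateAt′ j i j≢i v)))
  , subst₂ (CycleAdj k) (sym (lookup∘updateAt i v)) (sym (lookup∘updateAt i v)) adj

copy-residue : ∀ {m} b a → ¬ 2 ∣ b * a → (H : InducedSubgraph (b * a) m) →
  ∀ {n} (K : Copy H n) default v i → (∀ z → v [ i ]≔ z ∈ vs H) →
  ∀ {x y} → remainder {b} a x ≡ remainder {b} a y →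
  residue b a (extension H K default (v [ i ]≔ x)) ≡ residue b a (extension H K default (v [ i ]≔ y))
copy-residue b a 2∤k H K default v i line⊆H = cycle-residue b a 2∤k
  (λ z → extension H K default (v [ i ]≔ z))
  (λ x y adj → extension-adj H K default (line⊆H x) (line⊆H y) (TorusAdj-update v i adj))

-- Tags for the pieces, and the form of an odd number

module _ {k : ℕ} {x₀ x₁ : Fin k} (x₀≢x₁ : x₀ ≢ x₁) where

  -- Any injection of `Fin N` into the vertices would do: the tag only keeps the `N` pieces of `H`
  -- disjoint.
  unitVector : ∀ {N} → Fin N → Vertex k N
  unitVector i = replicate _ x₀ [ i ]≔ x₁

  unitVector-injective : ∀ {N} {i j : Fin N} → unitVector i ≡ unitVector j → i ≡ j
  unitVector-injective {N} {i} {j} eq with i Fin.≟ j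
  ... | yes i≡j = i≡j
  ... | no  i≢j = contradiction (begin
      x₀                     ≡⟨ lookup-replicate i x₀ ⟨
      lookup (replicate N x₀) i ≡⟨ lookup∘updateAt′ i j i≢j (replicate N x₀) ⟨
      lookup (unitVector j) i ≡⟨ cong (λ v → lookup v i) eq ⟨
      lookup (unitVector i) i ≡⟨ lookup∘updateAt i (replicate N x₀) ⟩
      x₁                     ∎) x₀≢x₁
    where
    open ≡-Reasoning

-- Half of `k - 1` is given as a successor, since the multiplicity `n₁` contains it diminished by
-- one.
odd-form : ∀ k → 3 ≤ k → ¬ 2 ∣ k → ∃ λ s → k ≡ 1 + 2 * suc s
odd-form 3                           _   _   = 0 , refl
odd-form 4                           _   2∤4 = contradiction (divides 2 refl) 2∤4
odd-form (suc (suc k@(suc (suc (suc _))))) _ 2∤k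
  with s , k≡ ← odd-form k (s≤s (s≤s (s≤s z≤n))) (2∤k ∘ ∣m∣n⇒∣m+n ∣-refl) =
  suc s , trans (cong (2 +_) k≡) (shift s)
  where
  shift : ∀ s → 2 + (1 + 2 * suc s) ≡ 1 + 2 * suc (suc s)
  shift = solve-∀
odd-form 0 () _
odd-form 1 (s≤s ()) _
odd-form 2 (s≤s (s≤s ())) _

-- The subgraph H and its order

module Construction (a c s : ℕ) (1<a : 1 < a) where

  b k n₁ n₂ N : ℕ
  b  = a + c
  k  = b * a
  -- In the application k = 1 + 2 * suc s, and then
  --   n₁ * b * (b + c) + n₂ * (b * b + b * c + c * c) = k * b ^ 4.
  -- The signed solution n₁ = - k * b * c, n₂ = k * b * b is made nonnegative by adding
  -- suc s * (b * b + b * c + c * c) to n₁ and subtracting suc s * b * (b + c) from n₂.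
  n₁ = suc s * (a * a) + s * (b * c)
  n₂ = b * (suc s * a + b)
  N  = n₁ + n₂

  1<b : 1 < b
  1<b = ≤-trans 1<a (m≤m+n a c)

  1<k : 1 < k
  1<k = *-mono-≤ 1<b (≤-trans (n≤1+n 1) 1<a)

  x₀ x₁ : Fin k
  x₀ = fromℕ< (≤-trans (n≤1+n 1) 1<k)
  x₁ = fromℕ< 1<k

  x₀≢x₁ : x₀ ≢ x₁
  x₀≢x₁ eq = contradiction (fromℕ<-injective _ _ _ _ eq) λ ()

  o∈lows : fromℕ< (≤-trans (n≤1+n 1) 1<a) ↑ˡ c ∈ lows a c
  o∈lows = ∈-map⁺ (_↑ˡ c) (∈-allFin _)

  thin thick : List (Triple b)
  thin  = slab a c []
  thick = slab a c (lows a c)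

  Place : Set
  Place = Fin N × Triple a × Triple b

  places : List Place
  places = split n₁ n₂ (cartesianProduct (allTriples a) thin) (cartesianProduct (allTriples a) thick)

  unit : Fin N → Vertex k N
  unit = unitVector x₀≢x₁

  -- A place consists of a tag, three residues and three quotients. As `combine t r` has value
  -- `a * t + r`, a quotient is low, that is below `a`, exactly when its coordinate is below
  -- `a * a`.
  vertexAt : Place → Vertex k (3 + N)
  vertexAt (w , (r₁ , r₂ , r₃) , (t₁ , t₂ , t₃)) =
    combine t₁ r₁ ∷ combine t₂ r₂ ∷ combine t₃ r₃ ∷ unit w

  vertexAt-injective : ∀ {p q} → vertexAt p ≡ vertexAt q → p ≡ q
  vertexAt-injective
    {w , (r₁ , r₂ , r₃) , (t₁ , t₂ , t₃)} {w′ , (r₁′ , r₂′ , r₃′) , (t₁′ , t₂′ , t₃′)} eq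
    with eq₁ , tail₁ ← ∷-injective eq
    with eq₂ , tail₂ ← ∷-injective tail₁
    with eq₃ , eq₄ ← ∷-injective tail₂
    with refl , refl ← combine-injective t₁ r₁ t₁′ r₁′ eq₁
    with refl , refl ← combine-injective t₂ r₂ t₂′ r₂′ eq₂
    with refl , refl ← combine-injective t₃ r₃ t₃′ r₃′ eq₃
    with refl ← unitVector-injective x₀≢x₁ eq₄
    = refl

  places-unique : Unique places
  places-unique = split-unique n₁ n₂
    (Unique.cartesianProduct⁺ (allTriples-unique a) (slab-unique a c []))
    (Unique.cartesianProduct⁺ (allTriples-unique a) (slab-unique a c (lows-unique a c)))

  H : InducedSubgraph k (3 + N)
  H = induced (List.map vertexAt places) (Unique.map⁺ vertexAt-injective places-unique)

  -- Each tag carries `a ^ 3` residue triples, each with one slab of quotients. Both slab sizes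
  -- contain a further factor `a`, and `multiplicity-identity` turns the rest into `k * b ^ 4`.
  order-H : k ≡ 1 + 2 * suc s → order H ≡ k ^ 5
  order-H k≡ = begin
    order H
      ≡⟨ length-map vertexAt places ⟩
    length places
      ≡⟨ length-split n₁ n₂ ⟩
    n₁ * length (cartesianProduct (allTriples a) thin)
      + n₂ * length (cartesianProduct (allTriples a) thick)
      ≡⟨ cong₂ (λ x y → n₁ * x + n₂ * y)
           (fibre-size thin (length-slab a c)) (fibre-size thick (length-slab a c)) ⟩
    n₁ * (a * (a * a) * (a * (b * b) + c * (a * b + c * 0)))
      + n₂ * (a * (a * a) * (a * (b * b) + c * (a * b + c * length (lows a c))))
      ≡⟨ cong (λ x → n₁ * (a * (a * a) * (a * (b * b) + c * (a * b + c * 0)))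
                     + n₂ * (a * (a * a) * (a * (b * b) + c * (a * b + c * x)))) (length-lows a c) ⟩
    n₁ * (a * (a * a) * (a * (b * b) + c * (a * b + c * 0)))
      + n₂ * (a * (a * a) * (a * (b * b) + c * (a * b + c * a)))
      ≡⟨ collect a b c n₁ (suc s * a + b) ⟩
    a * a * a * a * b * (n₁ * (b + c) + (suc s * a + b) * (b * b + c * b + c * c))
      ≡⟨ cong (a * a * a * a * b *_) (trans (multiplicity-identity a c s) (cong (_* (b * (b * b))) (sym k≡))) ⟩
    a * a * a * a * b * (k * (b * (b * b)))
      ≡⟨ regroup a b ⟩
    k ^ 5 ∎
    where
    open ≡-Reasoning
    fibre-size : ∀ T {l} → length T ≡ l → length (cartesianProduct (allTriples a) T) ≡ a * (a * a) * l
    fibre-size T eq = trans (length-cartesianProduct (allTriples a) T) (cong₂ _*_ (length-allTriples a) eq)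
    collect : ∀ a b c n₁ p →
      n₁ * (a * (a * a) * (a * (b * b) + c * (a * b + c * 0)))
        + b * p * (a * (a * a) * (a * (b * b) + c * (a * b + c * a)))
      ≡ a * a * a * a * b * (n₁ * (b + c) + p * (b * b + c * b + c * c))
    collect = solve-∀
    regroup : ∀ a b → a * a * a * a * b * (b * a * (b * (b * b)))
              ≡ b * a * (b * a * (b * a * (b * a * (b * a * 1))))
    regroup = solve-∀

  order-H-∣ : k ≡ 1 + 2 * suc s → order H ∣ k ^ (3 + N)
  order-H-∣ k≡ = subst (_∣ k ^ (3 + N)) (sym (order-H k≡))
    (subst (λ e → k ^ 5 ∣ k ^ e) (m+[n∸m]≡n 5≤)
      (subst (k ^ 5 ∣_) (sym (^-distribˡ-+-* k 5 (3 + N ∸ 5))) (m∣m*n (k ^ (3 + N ∸ 5)))))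
    where
    -- The order is the fifth power of `k`, so at least two tag coordinates are needed; `n₂` is a
    -- positive multiple of `b`, which exceeds 1.
    5≤ : 5 ≤ 3 + N
    5≤ = +-monoʳ-≤ 3 (begin
      2                      ≤⟨ 1<b ⟩
      b                      ≤⟨ m≤m*n b (suc s * a + b) {{>-nonZero 0<n₂/b}} ⟩
      n₂                     ≤⟨ m≤n+m n₂ n₁ ⟩
      N                      ∎)
      where
      open ≤-Reasoning
      0<n₂/b : 0 < suc s * a + b
      0<n₂/b = ≤-trans (<⇒≤ 1<b) (m≤n+m b (suc s * a))

  -- Every copy meets colour class 0 in a multiple of a

  module _ (2∤k : ¬ 2 ∣ k) {n} (K : Copy H n) where

    ψ : Vertex k (3 + N) → Vertex k n
    ψ = extension H K (replicate n x₀)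

    -- For a fixed tag and fixed residues the copy has a single colour, so the sum is the slab size
    -- times 0 or 1. Every term of the slab size is a multiple of `a` once `length zs` is.
    fibre-∣ : ∀ {zs} w r → a ∣ length zs → (∀ r {t} → t ∈ slab a c zs → (w , r , t) ∈ places) →
              a ∣ sumOf (λ t → weight b a (ψ (vertexAt (w , r , t)))) (slab a c zs)
    fibre-∣ {zs} w r@(r₁ , r₂ , r₃) a∣zs fibre⊆ = subst (a ∣_)
      (sym (sumOf-const (slab a c zs) (cong δ₀ⁿ ∘ slab-connected a c line-constant o∈lows)))
      (∣m⇒∣m*n _ (subst (a ∣_) (sym (length-slab a c))
        (∣m∣n⇒∣m+n (m∣m*n (b * b)) (∣n⇒∣m*n c (∣m∣n⇒∣m+n (m∣m*n b) (∣n⇒∣m*n c a∣zs))))))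
      where
      same : ∀ t t′ (q : Fin a) → remainder {b} a (combine t q) ≡ remainder {b} a (combine t′ q)
      same t t′ q = trans (cong proj₂ (remQuot-combine t q)) (sym (cong proj₂ (remQuot-combine t′ q)))
      ∈H : ∀ {r t} → t ∈ slab a c zs → vertexAt (w , r , t) ∈ vs H
      ∈H {r} t∈ = ∈-map⁺ vertexAt (fibre⊆ r t∈)
      move : ∀ t i → (∀ z → vertexAt (w , r , t) [ i ]≔ z ∈ vs H) → ∀ {x y} →
             remainder {b} a x ≡ remainder {b} a y →
             residue b a (ψ (vertexAt (w , r , t) [ i ]≔ x)) ≡
             residue b a (ψ (vertexAt (w , r , t) [ i ]≔ y))
      move t = copy-residue b a 2∤k H K (replicate n x₀) (vertexAt (w , r , t))
      -- A torus line through a point of the fibre runs through all residues of the moving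
      -- coordinate. It still lies in `H`, because membership depends on the tag and quotients only;
      -- this is why `fibre⊆` ranges over every residue triple.
      line-constant : LineConstant (slab a c zs) (λ t → residue b a (ψ (vertexAt (w , r , t))))
      line-constant = record
        { line₁ = λ {y} {z} full x x′ → move (x , y , z) zero
            (λ v → let (q , p , eq) = combine-surjective {b} {a} v in
              subst (λ v → v ∷ _ ∈ vs H) eq (∈H (full q))) (same x x′ r₁)
        ; line₂ = λ {x} {z} full y y′ → move (x , y , z) (suc zero)
            (λ v → let (q , p , eq) = combine-surjective {b} {a} v in
              subst (λ v → _ ∷ v ∷ _ ∈ vs H) eq (∈H (full q))) (same y y′ r₂)
        ; line₃ = λ {x} {y} full z z′ → move (x , y , z) (suc (suc zero))
            (λ v → let (q , p , eq) = combine-surjective {b} {a} v in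
              subst (λ v → _ ∷ _ ∷ v ∷ _ ∈ vs H) eq (∈H (full q))) (same z z′ r₃)
        }

    copy-∣ : a ∣ sumOf (weight b a ∘ φ K) (allFin (order H))
    copy-∣ = subst (a ∣_) (sym (begin
        sumOf (weight b a ∘ φ K) (allFin (order H))
          ≡⟨ sumOf-extension H K (replicate n x₀) (weight b a) ⟩
        sumOf (weight b a ∘ ψ) (vs H)
          ≡⟨ sumOf-map (weight b a ∘ ψ) vertexAt places ⟩
        sumOf (weight b a ∘ ψ ∘ vertexAt) places
          ≡⟨ sumOf-++ _ thinPlaces thickPlaces ⟩
        sumOf (weight b a ∘ ψ ∘ vertexAt) thinPlaces + sumOf (weight b a ∘ ψ ∘ vertexAt) thickPlaces ∎))
      (∣m∣n⇒∣m+n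
        (∣-sumOf-product _ _,_ (lows n₁ n₂) _ λ {w} w∈ →
          -- In the thin slab `zs` is empty, of length 0; in the thick one it has length `a`.
          ∣-sumOf-product _ _,_ (allTriples a) thin λ {r} _ →
            fibre-∣ w r (a ∣0) λ r t∈ → ∈-split-low n₁ n₂ w∈ (∈-cartesianProduct⁺ (∈-allTriples r) t∈))
        (∣-sumOf-product _ _,_ (highs n₁ n₂) _ λ {w} w∈ →
          ∣-sumOf-product _ _,_ (allTriples a) thick λ {r} _ →
            fibre-∣ w r (∣-reflexive (sym (length-lows a c)))
              λ r t∈ → ∈-split-high n₁ n₂ w∈ (∈-cartesianProduct⁺ (∈-allTriples r) t∈)))
      where
      open ≡-Reasoning
      thinPlaces thickPlaces : List Place
      thinPlaces  = cartesianProduct (lows n₁ n₂) (cartesianProduct (allTriples a) thin)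
      thickPlaces = cartesianProduct (highs n₁ n₂) (cartesianProduct (allTriples a) thick)

theorem1p5 : (k : ℕ) → 3 ≤ k → ¬ (2 ∣ k) → ¬ IsPrimePower k →
    Σ ℕ λ m → 1 ≤ m × Σ (InducedSubgraph k m) λ H →
    (order H ∣ k ^ m) × (∀ n → 1 ≤ n → ¬ PerfectPacking H n)
theorem1p5 k 3≤k 2∤k not-pp with coprime-splitting k (≤-trans (n≤1+n 2) 3≤k) not-pp
... | a , b′ , 1<a , a<b , a⊥b , refl
  with s , k≡ ← odd-form k 3≤k 2∤k
  -- The larger factor is rewritten as `a + c`, the form in which the construction takes it.
  with c , refl ← m≤n⇒∃[o]m+o≡n (<⇒≤ a<b)
  = 3 + N , s≤s z≤n , H , order-H-∣ k≡ ,
    λ n _ → divisible-weight⇒no-packing b a 1<a (λ {d} → a⊥b {d}) H (copy-∣ 2∤k) n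
  where open Construction a c s 1<a
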